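{- Let $\sigma, \tau \in S_n$ with ${\rm hd}(\sigma,\tau) = d$. Let $m \in \{1, \ldots, n-1\}$ and assume that the disjoint cycle decomposition of $\sigma^{ -1}\tau$ has no factor of odd length $\ell$ with $3 \leq \ell \leq 2m+1$. Then ${\rm hd}\big(\sigma^{\mathsf{CT}^m},\tau^{\mathsf{CT}^m}\big) \geq d - 2m$.
   Context: $S_n$ is the symmetric group on the symbols $\{0,1,\ldots,n-1\}$. Permutations are composed from left to right: for $\sigma,\tau\in S_n$, $\tau\sigma(x):=\sigma(\tau(x))$; thus $\sigma^{ -1}\tau(x)=\tau(\sigma^{ -1}(x))$. The Hamming distance is ${\rm hd}(\sigma,\tau)=|\{x\in\{0,\ldots,n-1\}: \sigma(x)\neq\tau(x)\}|$. The contraction of $\sigma\in S_n$ is the permutation $\sigma^{\mathsf{CT}}\in S_{n-1}$ (on $\{0,\ldots,n-2\}$) defined by $\sigma^{\mathsf{CT}}(x)=\sigma(n-1)$ if $x=\sigma^{ -1}(n-1)$ and $\sigma^{\mathsf{CT}}(x)=\sigma(x)$ otherwise; equivalently, it is obtained by deleting the symbol $n-1$ from the disjoint cycle notation of $\sigma$. For $1\le m\le n-1$, $\sigma^{\mathsf{CT}^m}:=\big(\sigma^{\mathsf{CT}^{m-1}}\big)^{\mathsf{CT}}$ (with $\sigma^{\mathsf{CT}^0}=\sigma$), where at each step the largest symbol is deleted. The length of a cycle is the number of symbols it moves; fixed points are regarded as lying in cycles of length zero. -}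

module Defs where

open import Data.Nat using (ℕ; zero; suc; _+_; _≤_; _<_; _<?_)
open import Data.Fin using (Fin; toℕ; fromℕ<; inject₁; fromℕ; _≟_)
open import Data.List using (List; length; filter)
open import Data.Fin.Permutation using (Permutation′; _⟨$⟩ʳ_; _⟨$⟩ˡ_)
open import Data.List using (allFin)
open import Data.Product using (_×_)
open import Relation.Nullary using (¬_; yes; no)
open import Relation.Nullary.Decidable using (¬?)
open import Relation.Binary.PropositionalEquality using (_≡_; _≢_)

hd : ∀ {n} → (Fin n → Fin n) → (Fin n → Fin n) → ℕ
hd {n} σ τ = length (filter (λ x → ¬? (σ x ≟ τ x)) (allFin n))

-- Move an element of Fin (suc n) into Fin n when it is not the largest
-- symbol; the fallback d is only used for the largest symbol n.
trim : ∀ {n} → Fin n → Fin (suc n) → Fin n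
trim {n} d y with toℕ y <? n
... | yes p = fromℕ< p
... | no _ = d

-- Contraction (on the underlying map of a permutation of Fin (suc n)):
-- x ↦ σ(n) if σ(x) = n, and x ↦ σ(x) otherwise.  For a permutation σ
-- and x < n, the resulting value is never the symbol n, so trim never
-- uses its fallback; this is exactly deletion of n from the cycle notation.
ct : ∀ {n} → (Fin (suc n) → Fin (suc n)) → (Fin n → Fin n)
ct {n} σ x with σ (inject₁ x) ≟ fromℕ n
... | yes _ = trim x (σ (fromℕ n))
... | no _ = trim x (σ (inject₁ x))

ctIter : ∀ m {k} → (Fin (m + k) → Fin (m + k)) → (Fin k → Fin k)
ctIter zero f = f
ctIter (suc m) f = ctIter m (ct f)

⟦_⟧ : ∀ {n} → Permutation′ n → (Fin n → Fin n)
⟦ π ⟧ x = π ⟨$⟩ʳ x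

-- σ⁻¹τ with left-to-right composition: x ↦ τ(σ⁻¹(x)).
invComp : ∀ {n} → Permutation′ n → Permutation′ n → (Fin n → Fin n)
invComp σ τ x = τ ⟨$⟩ʳ (σ ⟨$⟩ˡ x)

iter : ∀ {A : Set} → (A → A) → ℕ → A → A
iter f zero x = x
iter f (suc j) x = f (iter f j x)

-- x lies in a cycle of π of length ℓ (ℓ = minimal period of x; ℓ = 1
-- for fixed points, which the paper calls cycles of length zero).
InCycleOfLength : ∀ {n} → (Fin n → Fin n) → Fin n → ℕ → Set
InCycleOfLength π x ℓ =
  (1 ≤ ℓ) × (iter π ℓ x ≡ x) × (∀ j → 1 ≤ j → j < ℓ → iter π j x ≢ x)

data Odd : ℕ → Set where
  odd : ∀ k → Odd (suc (k + k))

{-# OPTIONS --safe #-}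
-- Put M = m + 1 and give a cycle of σ⁻¹τ of length 2j the weight 2jM, and one
-- of length 2j + 1 the weight 2jM + min(j, M). Fixed points have weight 0, no
-- cycle of length ℓ weighs more than Mℓ, and a nontrivial cycle weighs exactly
-- Mℓ unless ℓ is odd and at most 2m + 1. So the total weight W satisfies
-- W ≤ M hd(σ, τ), with equality under the hypothesis on odd cycles. A
-- contraction drops one symbol and splits one cycle of σ⁻¹τ in two, one part
-- possibly empty, or merges two cycles; either way W falls by at most 2M + 1.
-- After m contractions M d ≤ M hd + m (2M + 1), and since m < M this gives
-- d ≤ hd + 2m.
module Submission where

open import Defs
open import Data.Nat using (ℕ; suc; _+_; _*_; _∸_; _≤_; _≥_)
open import Data.Fin using (Fin)
open import Data.Fin.Permutation using (Permutation′)
open import Relation.Nullary using (¬_)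
open import Relation.Binary.PropositionalEquality using (_≡_)

open import Data.Empty using (⊥-elim)
open import Data.Fin using (zero; suc; toℕ; fromℕ; inject₁) renaming (_≟_ to _≟ᶠ_)
open import Data.Fin.Permutation using (_⟨$⟩ˡ_; inverseˡ; inverseʳ; flip)
open import Data.Fin.Properties
  using (inject₁-injective; fromℕ≢inject₁; injective⇒existsPivot; ≤fromℕ; toℕ-injective;
         toℕ-fromℕ; toℕ-fromℕ<; toℕ-inject₁; toℕ≤pred[n])
open import Data.List
  using (List; []; _∷_; [_]; _++_; map; concat; length; filter; allFin; tabulate)
open import Data.List.Properties
  using (++-assoc; ++-identityʳ; length-++; length-map; map-∘; map-id; map-cong; map-tabulate;
         concat-map; ∷-injective; filter-++; filter-all; filter-reject; length-filter)
open import Data.List.Membership.Propositional using (_∈_)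
open import Data.List.Membership.Propositional.Properties
  using (∈-++⁻; ∈-∃++; ∈-concat⁻′; ∈-allFin)
open import Data.List.Relation.Binary.Permutation.Propositional
  using (_↭_; refl; prep; swap; ↭-refl; ↭-sym; ↭-trans; ↭-reflexive; ↭⇒↭ₛ;
         module PermutationReasoning)
open import Data.List.Relation.Binary.Permutation.Propositional.Properties
  using (All-resp-↭; ∈-resp-↭; map⁺; ++⁺ˡ; ++⁺ʳ; ++-comm; shift; shifts; drop-mid; ↭-map-inv;
         ↭-length; filter-↭)
import Data.List.Relation.Binary.Permutation.Setoid.Properties as Permₛ
open import Data.List.Relation.Unary.All as All using (All; []; _∷_)
import Data.List.Relation.Unary.All.Properties as All
open import Data.List.Relation.Unary.AllPairs using ([]; _∷_)
open import Data.List.Relation.Unary.Any using (here; there)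
open import Data.List.Relation.Unary.Unique.Propositional using (Unique)
open import Data.List.Relation.Unary.Unique.Propositional.Properties using (allFin⁺)
open import Data.Nat using (zero; _<_; _⊓_; z≤n; s≤s; _<?_)
open import Data.Nat.ListAction using (sum)
open import Data.Nat.ListAction.Properties using (sum-↭)
open import Data.Nat.Properties
  using (≤-trans; ≤-reflexive; ≤-antisym; ≤∧≢⇒<; ≮⇒≥; module ≤-Reasoning;
         +-comm; +-assoc; +-suc; +-identityʳ; *-distribʳ-+; *-distribˡ-+; *-zeroʳ;
         +-mono-≤; +-monoˡ-≤; +-monoʳ-≤; *-monoʳ-≤; *-monoˡ-≤; m≤m+n; m≤n+m; +-cancelˡ-≤;
         ⊓-sel; m⊓n≤m; m⊓n≤n; m≥n⇒m⊓n≡n; m≤n+o⇒m∸n≤o; 1+n≰n)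
open import Data.Nat.Tactic.RingSolver using (solve-∀)
open import Data.Product using (∃; ∃₂; _×_; _,_)
open import Data.Sum using (inj₁; inj₂)
open import Data.Unit using (⊤; tt)
open import Function using (_∘_; id; case_of_)
open import Function.Definitions using (Injective)
open import Relation.Binary.Definitions using (DecidableEquality)
open import Relation.Unary using (Decidable)
open import Relation.Binary.PropositionalEquality
  using (_≢_; refl; sym; trans; cong; cong₂; subst; subst₂; setoid; module ≡-Reasoning)
open import Relation.Nullary using (yes; no; contradiction)
open import Relation.Nullary.Decidable using (¬?)

private variable
  A B V V′ : Set

-- Weights of cycle lengths

data Half : ℕ → Set where
  even : ∀ i → Half (i * 2)
  odd  : ∀ i → Half (suc (i * 2))

half : ∀ n → Half n
half 0 = even 0
half 1 = odd 0
half (suc (suc n)) with half n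
... | even i = even (suc i)
... | odd i  = odd (suc i)

module _ (M : ℕ) where

  -- weightFrom i n is the weight of a cycle of length 2i + n.
  weightFrom : ℕ → ℕ → ℕ
  weightFrom i 0 = i * (2 * M)
  weightFrom i 1 = i * (2 * M) + i ⊓ M
  weightFrom i (suc (suc n)) = weightFrom (suc i) n

  weight : ℕ → ℕ
  weight = weightFrom 0

  weightFrom-even : ∀ i j → weightFrom i (j * 2) ≡ (j + i) * (2 * M)
  weightFrom-even i zero = refl
  weightFrom-even i (suc j) =
    trans (weightFrom-even (suc i) j) (cong (_* (2 * M)) (+-suc j i))

  weightFrom-odd : ∀ i j → weightFrom i (suc (j * 2)) ≡ (j + i) * (2 * M) + (j + i) ⊓ M
  weightFrom-odd i zero = refl
  weightFrom-odd i (suc j) =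
    trans (weightFrom-odd (suc i) j) (cong (λ h → h * (2 * M) + h ⊓ M) (+-suc j i))

  weight-even : ∀ j → weight (j * 2) ≡ j * (2 * M)
  weight-even j = trans (weightFrom-even 0 j) (cong (_* (2 * M)) (+-identityʳ j))

  weight-odd : ∀ j → weight (suc (j * 2)) ≡ j * (2 * M) + j ⊓ M
  weight-odd j =
    trans (weightFrom-odd 0 j) (cong (λ h → h * (2 * M) + h ⊓ M) (+-identityʳ j))

  -- If either minimum is `M`, the right side already contains `M`. Otherwise both minima are `i`
  -- and `j` themselves, and the `+ 1` absorbs the successor.
  suc-⊓-+ : ∀ i j → suc (i + j) ⊓ M ≤ i ⊓ M + j ⊓ M + 1
  suc-⊓-+ i j with ⊓-sel i M | ⊓-sel j M
  ... | inj₂ i⊓M≡M | _ = begin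
    suc (i + j) ⊓ M      ≤⟨ m⊓n≤n _ M ⟩
    M                    ≤⟨ m≤m+n M _ ⟩
    M + (j ⊓ M + 1)      ≡⟨ cong (_+ (j ⊓ M + 1)) i⊓M≡M ⟨
    i ⊓ M + (j ⊓ M + 1)  ≡⟨ +-assoc (i ⊓ M) _ 1 ⟨
    i ⊓ M + j ⊓ M + 1    ∎
    where open ≤-Reasoning
  ... | inj₁ _ | inj₂ j⊓M≡M = begin
    suc (i + j) ⊓ M      ≤⟨ m⊓n≤n _ M ⟩
    M                    ≤⟨ m≤n+m M _ ⟩
    i ⊓ M + M            ≡⟨ cong (i ⊓ M +_) j⊓M≡M ⟨
    i ⊓ M + j ⊓ M        ≤⟨ m≤m+n _ 1 ⟩
    i ⊓ M + j ⊓ M + 1    ∎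
    where open ≤-Reasoning
  ... | inj₁ i⊓M≡i | inj₁ j⊓M≡j = begin
    suc (i + j) ⊓ M      ≤⟨ m⊓n≤m _ M ⟩
    suc (i + j)          ≡⟨ +-comm 1 (i + j) ⟩
    i + j + 1            ≡⟨ cong₂ (λ a b → a + b + 1) i⊓M≡i j⊓M≡j ⟨
    i ⊓ M + j ⊓ M + 1    ∎
    where open ≤-Reasoning

  -- `2 * M` is the weight of one pair of symbols. The extra 1 is what a split into two odd parts
  -- can cost on top, through `suc-⊓-+`.
  loss : ℕ
  loss = suc (2 * M)

  -- This is the cost of deleting one symbol and cutting the rest into parts `p` and `q`. If both
  -- are even, no pair is lost, only a capped term of at most `M`. If one is odd, one pair is lost.
  -- If both are odd, one pair is lost and the capped term on the left exceeds those on the right by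
  -- at most 1.
  weight-split : ∀ p q → weight (p + suc q) ≤ weight p + weight q + loss
  weight-split p q with half p | half q
  ... | even i | even j = begin
    weight (i * 2 + suc (j * 2))              ≡⟨ cong weight (double i j) ⟩
    weight (suc ((i + j) * 2))                ≡⟨ weight-odd (i + j) ⟩
    (i + j) * (2 * M) + (i + j) ⊓ M           ≤⟨ +-monoʳ-≤ _ (m⊓n≤n (i + j) M) ⟩
    (i + j) * (2 * M) + M                     ≤⟨ m≤m+n _ (suc M) ⟩
    (i + j) * (2 * M) + M + suc M             ≡⟨ arith i j M ⟩
    i * (2 * M) + j * (2 * M) + loss          ≡⟨ cong₂ (λ a b → a + b + loss) (weight-even i) (weight-even j) ⟨
    weight (i * 2) + weight (j * 2) + loss    ∎
    where
    open ≤-Reasoning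
    double : ∀ i j → i * 2 + suc (j * 2) ≡ suc ((i + j) * 2)
    double = solve-∀
    arith : ∀ i j M → (i + j) * (2 * M) + M + suc M ≡ i * (2 * M) + j * (2 * M) + suc (2 * M)
    arith = solve-∀
  ... | even i | odd j = begin
    weight (i * 2 + suc (suc (j * 2)))        ≡⟨ cong weight (double i j) ⟩
    weight (suc (i + j) * 2)                  ≡⟨ weight-even (suc (i + j)) ⟩
    suc (i + j) * (2 * M)                     ≤⟨ m≤m+n _ (suc (j ⊓ M)) ⟩
    suc (i + j) * (2 * M) + suc (j ⊓ M)       ≡⟨ arith i j M (j ⊓ M) ⟩
    i * (2 * M) + (j * (2 * M) + j ⊓ M) + loss
      ≡⟨ cong₂ (λ a b → a + b + loss) (weight-even i) (weight-odd j) ⟨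
    weight (i * 2) + weight (suc (j * 2)) + loss    ∎
    where
    open ≤-Reasoning
    double : ∀ i j → i * 2 + suc (suc (j * 2)) ≡ suc (i + j) * 2
    double = solve-∀
    arith : ∀ i j M x → suc (i + j) * (2 * M) + suc x ≡
                        i * (2 * M) + (j * (2 * M) + x) + suc (2 * M)
    arith = solve-∀
  ... | odd i | even j = begin
    weight (suc (i * 2) + suc (j * 2))        ≡⟨ cong weight (double i j) ⟩
    weight (suc (i + j) * 2)                  ≡⟨ weight-even (suc (i + j)) ⟩
    suc (i + j) * (2 * M)                     ≤⟨ m≤m+n _ (suc (i ⊓ M)) ⟩
    suc (i + j) * (2 * M) + suc (i ⊓ M)       ≡⟨ arith i j M (i ⊓ M) ⟩
    i * (2 * M) + i ⊓ M + j * (2 * M) + loss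
      ≡⟨ cong₂ (λ a b → a + b + loss) (weight-odd i) (weight-even j) ⟨
    weight (suc (i * 2)) + weight (j * 2) + loss    ∎
    where
    open ≤-Reasoning
    double : ∀ i j → suc (i * 2) + suc (j * 2) ≡ suc (i + j) * 2
    double = solve-∀
    arith : ∀ i j M x → suc (i + j) * (2 * M) + suc x ≡
                        i * (2 * M) + x + j * (2 * M) + suc (2 * M)
    arith = solve-∀
  ... | odd i | odd j = begin
    weight (suc (i * 2) + suc (suc (j * 2)))           ≡⟨ cong weight (double i j) ⟩
    weight (suc (suc (i + j) * 2))                     ≡⟨ weight-odd (suc (i + j)) ⟩
    suc (i + j) * (2 * M) + suc (i + j) ⊓ M            ≤⟨ +-monoʳ-≤ _ (suc-⊓-+ i j) ⟩
    suc (i + j) * (2 * M) + (i ⊓ M + j ⊓ M + 1)        ≡⟨ arith i j M (i ⊓ M) (j ⊓ M) ⟩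
    i * (2 * M) + i ⊓ M + (j * (2 * M) + j ⊓ M) + loss
      ≡⟨ cong₂ (λ a b → a + b + loss) (weight-odd i) (weight-odd j) ⟨
    weight (suc (i * 2)) + weight (suc (j * 2)) + loss ∎
    where
    open ≤-Reasoning
    double : ∀ i j → suc (i * 2) + suc (suc (j * 2)) ≡ suc (suc (i + j) * 2)
    double = solve-∀
    arith : ∀ i j M x y → suc (i + j) * (2 * M) + (x + y + 1) ≡
                          i * (2 * M) + x + (j * (2 * M) + y) + suc (2 * M)
    arith = solve-∀

  -- This is the cost of deleting one symbol from the first cycle and joining the rest to the
  -- second. By parity, the drop is at most one whole pair, or at most two capped terms, each
  -- bounded by `M`.
  weight-mergeable : ∀ p q → weight (suc p) + weight q ≤ weight (p + q) + loss
  weight-mergeable p q with half p | half q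
  ... | even i | even j = begin
    weight (suc (i * 2)) + weight (j * 2)     ≡⟨ cong₂ _+_ (weight-odd i) (weight-even j) ⟩
    i * (2 * M) + i ⊓ M + j * (2 * M)         ≤⟨ +-monoˡ-≤ _ (+-monoʳ-≤ (i * (2 * M)) (m⊓n≤n i M)) ⟩
    i * (2 * M) + M + j * (2 * M)             ≤⟨ m≤m+n _ (suc M) ⟩
    i * (2 * M) + M + j * (2 * M) + suc M     ≡⟨ arith i j M ⟩
    (i + j) * (2 * M) + loss                  ≡⟨ cong (_+ loss) (weight-even (i + j)) ⟨
    weight ((i + j) * 2) + loss               ≡⟨ cong (λ h → weight h + loss) (*-distribʳ-+ 2 i j) ⟩
    weight (i * 2 + j * 2) + loss             ∎
    where
    open ≤-Reasoning
    arith : ∀ i j M → i * (2 * M) + M + j * (2 * M) + suc M ≡ (i + j) * (2 * M) + suc (2 * M)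
    arith = solve-∀
  ... | even i | odd j = begin
    weight (suc (i * 2)) + weight (suc (j * 2)) ≡⟨ cong₂ _+_ (weight-odd i) (weight-odd j) ⟩
    i * (2 * M) + i ⊓ M + (j * (2 * M) + j ⊓ M)
      ≤⟨ +-mono-≤ (+-monoʳ-≤ (i * (2 * M)) (m⊓n≤n i M)) (+-monoʳ-≤ (j * (2 * M)) (m⊓n≤n j M)) ⟩
    i * (2 * M) + M + (j * (2 * M) + M)       ≤⟨ m≤m+n _ (suc ((i + j) ⊓ M)) ⟩
    i * (2 * M) + M + (j * (2 * M) + M) + suc ((i + j) ⊓ M) ≡⟨ arith i j M ((i + j) ⊓ M) ⟩
    (i + j) * (2 * M) + (i + j) ⊓ M + loss    ≡⟨ cong (_+ loss) (weight-odd (i + j)) ⟨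
    weight (suc ((i + j) * 2)) + loss         ≡⟨ cong (λ h → weight h + loss) (double i j) ⟨
    weight (i * 2 + suc (j * 2)) + loss       ∎
    where
    open ≤-Reasoning
    double : ∀ i j → i * 2 + suc (j * 2) ≡ suc ((i + j) * 2)
    double = solve-∀
    arith : ∀ i j M x → i * (2 * M) + M + (j * (2 * M) + M) + suc x ≡
                        (i + j) * (2 * M) + x + suc (2 * M)
    arith = solve-∀
  ... | odd i | even j = begin
    weight (suc i * 2) + weight (j * 2)         ≡⟨ cong₂ _+_ (weight-even (suc i)) (weight-even j) ⟩
    suc i * (2 * M) + j * (2 * M)               ≤⟨ m≤m+n _ (suc ((i + j) ⊓ M)) ⟩
    suc i * (2 * M) + j * (2 * M) + suc ((i + j) ⊓ M) ≡⟨ arith i j M ((i + j) ⊓ M) ⟩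
    (i + j) * (2 * M) + (i + j) ⊓ M + loss      ≡⟨ cong (_+ loss) (weight-odd (i + j)) ⟨
    weight (suc ((i + j) * 2)) + loss           ≡⟨ cong (λ h → weight (suc h) + loss) (*-distribʳ-+ 2 i j) ⟩
    weight (suc (i * 2) + j * 2) + loss         ∎
    where
    open ≤-Reasoning
    arith : ∀ i j M x → suc i * (2 * M) + j * (2 * M) + suc x ≡
                        (i + j) * (2 * M) + x + suc (2 * M)
    arith = solve-∀
  ... | odd i | odd j = begin
    weight (suc i * 2) + weight (suc (j * 2))   ≡⟨ cong₂ _+_ (weight-even (suc i)) (weight-odd j) ⟩
    suc i * (2 * M) + (j * (2 * M) + j ⊓ M)     ≤⟨ +-monoʳ-≤ (suc i * (2 * M)) (+-monoʳ-≤ (j * (2 * M)) (m⊓n≤n j M)) ⟩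
    suc i * (2 * M) + (j * (2 * M) + M)         ≤⟨ m≤m+n _ (suc M) ⟩
    suc i * (2 * M) + (j * (2 * M) + M) + suc M ≡⟨ arith i j M ⟩
    suc (i + j) * (2 * M) + loss                ≡⟨ cong (_+ loss) (weight-even (suc (i + j))) ⟨
    weight (suc (i + j) * 2) + loss             ≡⟨ cong (λ h → weight h + loss) (double i j) ⟨
    weight (suc (i * 2) + suc (j * 2)) + loss   ∎
    where
    open ≤-Reasoning
    double : ∀ i j → suc (i * 2) + suc (j * 2) ≡ suc (i + j) * 2
    double = solve-∀
    arith : ∀ i j M → suc i * (2 * M) + (j * (2 * M) + M) + suc M ≡
                      suc (i + j) * (2 * M) + suc (2 * M)
    arith = solve-∀

  weight-≤ : ∀ n → weight n ≤ M * n
  weight-≤ n with half n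
  ... | even i = ≤-reflexive (trans (weight-even i) (arith i M))
    where
    arith : ∀ i M → i * (2 * M) ≡ M * (i * 2)
    arith = solve-∀
  ... | odd i = begin
    weight (suc (i * 2))    ≡⟨ weight-odd i ⟩
    i * (2 * M) + i ⊓ M     ≤⟨ +-monoʳ-≤ (i * (2 * M)) (m⊓n≤n i M) ⟩
    i * (2 * M) + M         ≡⟨ arith i M ⟩
    M * suc (i * 2)         ∎
    where
    open ≤-Reasoning
    arith : ∀ i M → i * (2 * M) + M ≡ M * suc (i * 2)
    arith = solve-∀

  -- Once `M ≤ i`, the capped term `i ⊓ M` is `M`, so an odd cycle pays in full for its unpaired
  -- symbol too and attains the bound of `weight-≤`.
  weight-≥ : ∀ n → (∀ i → n ≡ suc (i * 2) → M ≤ i) → M * n ≤ weight n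
  weight-≥ n long with half n
  ... | even i = ≤-reflexive (sym (trans (weight-even i) (arith i M)))
    where
    arith : ∀ i M → i * (2 * M) ≡ M * (i * 2)
    arith = solve-∀
  ... | odd i = ≤-reflexive (sym (begin
    weight (suc (i * 2))    ≡⟨ weight-odd i ⟩
    i * (2 * M) + i ⊓ M     ≡⟨ cong (i * (2 * M) +_) (m≥n⇒m⊓n≡n (long i refl)) ⟩
    i * (2 * M) + M         ≡⟨ arith i M ⟩
    M * suc (i * 2)         ∎))
    where
    open ≡-Reasoning
    arith : ∀ i M → i * (2 * M) + M ≡ M * suc (i * 2)
    arith = solve-∀

-- Lists and permutations

Unique-resp-↭ : {xs ys : List A} → xs ↭ ys → Unique xs → Unique ys
Unique-resp-↭ p = Permₛ.Unique-resp-↭ (setoid _) (↭⇒↭ₛ p)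

concat-↭ : {xss yss : List (List A)} → xss ↭ yss → concat xss ↭ concat yss
concat-↭ refl = ↭-refl
concat-↭ (prep xs p) = ++⁺ˡ xs (concat-↭ p)
concat-↭ (swap xs ys p) = ↭-trans (shifts xs ys) (++⁺ˡ ys (++⁺ˡ xs (concat-↭ p)))
concat-↭ (_↭_.trans p q) = ↭-trans (concat-↭ p) (concat-↭ q)

++-map⁻ : (h : A → B) → ∀ xs {ys zs} → xs ++ ys ≡ map h zs →
          ∃₂ λ xs′ ys′ → xs ≡ map h xs′ × ys ≡ map h ys′ × zs ≡ xs′ ++ ys′
++-map⁻ h [] eq = _ , _ , refl , eq , refl
++-map⁻ h (x ∷ xs) {zs = z ∷ zs} eq with ∷-injective eq
... | refl , eq′ with ++-map⁻ h xs eq′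
... | xs′ , ys′ , refl , refl , refl = z ∷ xs′ , ys′ , refl , refl , refl

concat-map⁻ : (h : A → B) → ∀ xss {zs} → concat xss ≡ map h zs →
              ∃ λ xss′ → xss ≡ map (map h) xss′ × zs ≡ concat xss′
concat-map⁻ h [] {[]} eq = [] , refl , refl
concat-map⁻ h (xs ∷ xss) eq with ++-map⁻ h xs eq
... | xs′ , _ , refl , eq′ , refl with concat-map⁻ h xss eq′
... | xss′ , refl , refl = xs′ ∷ xss′ , refl , refl

-- `allFin` grows at the front by `zero`, whereas contraction deletes the last symbol. The induction
-- rests on `suc` commuting with `inject₁`.
allFin-suc : ∀ n → allFin (suc n) ↭ fromℕ n ∷ map inject₁ (allFin n)
allFin-suc zero = ↭-refl
allFin-suc (suc n) = begin
  zero ∷ tabulate suc                              ≡⟨ cong (zero ∷_) (map-tabulate id suc) ⟨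
  zero ∷ map suc (allFin (suc n))                  ↭⟨ prep zero (map⁺ suc (allFin-suc n)) ⟩
  zero ∷ fromℕ (suc n) ∷ map suc (map inject₁ (allFin n))
    ↭⟨ swap zero (fromℕ (suc n)) ↭-refl ⟩
  fromℕ (suc n) ∷ zero ∷ map suc (map inject₁ (allFin n))
    ≡⟨ cong (λ xs → fromℕ (suc n) ∷ zero ∷ xs) shifted ⟩
  fromℕ (suc n) ∷ map inject₁ (allFin (suc n))     ∎
  where
  open PermutationReasoning
  shifted : map suc (map inject₁ (allFin n)) ≡ map inject₁ (tabulate suc)
  shifted = trans (cong (map suc) (map-tabulate id inject₁))
                  (trans (map-tabulate inject₁ suc) (sym (map-tabulate suc inject₁)))

-- Closed walks

-- A node x is an arrow from f x to g x. The closed walks of (σ, τ) are the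
-- cycles of σ⁻¹τ, the cycle through y being listed by the nodes x with σ x = y.
data Walk (f g : A → V) : V → List A → V → Set where
  []  : ∀ {v} → Walk f g v [] v
  _∷_ : ∀ {u x c v} → f x ≡ u → Walk f g (g x) c v → Walk f g u (x ∷ c) v

-- The empty list counts as closed, with weight 0, so that a split leaving one part empty still
-- yields two closed walks.
Closed : (f g : A → V) → List A → Set
Closed f g [] = ⊤
Closed f g (x ∷ c) = Walk f g (g x) c (f x)

module _ {f g : A → V} where

  walk-++⁺ : ∀ {u v w c d} → Walk f g u c v → Walk f g v d w → Walk f g u (c ++ d) w
  walk-++⁺ [] q = q
  walk-++⁺ (e ∷ p) q = e ∷ walk-++⁺ p q

  walk-++⁻ : ∀ {u w} c {d} → Walk f g u (c ++ d) w → ∃ λ v → Walk f g u c v × Walk f g v d w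
  walk-++⁻ [] q = _ , [] , q
  walk-++⁻ (x ∷ c) (e ∷ q) with walk-++⁻ c q
  ... | v , p , r = v , e ∷ p , r

  closed-rotate : ∀ c {x d} → Closed f g (c ++ x ∷ d) → Closed f g (x ∷ d ++ c)
  closed-rotate [] {x} {d} = subst (λ d → Walk f g (g x) d (f x)) (sym (++-identityʳ d))
  closed-rotate (y ∷ c) p with walk-++⁻ c p
  ... | _ , q , refl ∷ r = walk-++⁺ r (refl ∷ q)

  walk⇒closed : ∀ {v c} → Walk f g v c v → Closed f g c
  walk⇒closed [] = tt
  walk⇒closed (refl ∷ p) = p

module _ {f g : A → V} {f′ g′ : B → V′} {h : A → B} {k : V → V′}
         (f-comm : ∀ x → f′ (h x) ≡ k (f x)) (g-comm : ∀ x → g′ (h x) ≡ k (g x)) where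

  walk-map : ∀ {u c v} → Walk f g u c v → Walk f′ g′ (k u) (map h c) (k v)
  walk-map [] = []
  walk-map {c = x ∷ _} (refl ∷ p) =
    f-comm x ∷ subst (λ u → Walk f′ g′ u _ _) (sym (g-comm x)) (walk-map p)

  closed-map : ∀ {c} → Closed f g c → Closed f′ g′ (map h c)
  closed-map {[]} _ = tt
  closed-map {x ∷ _} p = subst₂ (λ u v → Walk f′ g′ u _ v) (sym (g-comm x)) (sym (f-comm x)) (walk-map p)

  module _ (k-inj : Injective _≡_ _≡_ k) where

    -- The endpoints are given up to equations because `g′ (h x)` is only propositionally `k (g x)`.
    -- Injectivity of `k` carries each coincidence of vertices back.
    walk-map⁻ : ∀ {u′ v′ u v} c → u′ ≡ k u → v′ ≡ k v →
                Walk f′ g′ u′ (map h c) v′ → Walk f g u c v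
    walk-map⁻ [] u≡ v≡ [] = subst (Walk f g _ []) (k-inj (trans (sym u≡) v≡)) []
    walk-map⁻ (x ∷ c) refl v≡ (e ∷ p) =
      k-inj (trans (sym (f-comm x)) e) ∷ walk-map⁻ c (g-comm x) v≡ p

    closed-map⁻ : ∀ c → Closed f′ g′ (map h c) → Closed f g c
    closed-map⁻ [] _ = tt
    closed-map⁻ (x ∷ c) = walk-map⁻ c (g-comm x) (f-comm x)

module _ {f g g′ : A → V} where

  walk-cong : ∀ {u c v} → All (λ x → g x ≡ g′ x) c → Walk f g u c v → Walk f g′ u c v
  walk-cong [] [] = []
  walk-cong (eq ∷ eqs) (e ∷ p) = e ∷ subst (λ u → Walk f g′ u _ _) eq (walk-cong eqs p)

  closed-cong : ∀ {c} → All (λ x → g x ≡ g′ x) c → Closed f g c → Closed f g′ c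
  closed-cong [] _ = tt
  closed-cong (eq ∷ eqs) p = subst (λ u → Walk f g′ u _ _) eq (walk-cong eqs p)

totalWeight : ℕ → List (List A) → ℕ
totalWeight M = sum ∘ map (weight M ∘ length)

-- Rotating a cycle and reordering the cycles keep all symbols and all lengths, hence the weight.
-- Cutting and joining can then assume a cycle that begins with the chosen node.
extract : ∀ {f g : A → V} M {x cs} → x ∈ concat cs → All (Closed f g) cs →
          ∃₂ λ c ds → All (Closed f g) ((x ∷ c) ∷ ds) × concat cs ↭ concat ((x ∷ c) ∷ ds) ×
                      totalWeight M cs ≡ totalWeight M ((x ∷ c) ∷ ds)
extract M {x} {cs} x∈ closed with ∈-concat⁻′ cs x∈
... | d , x∈d , d∈cs with ∈-∃++ x∈d | ∈-∃++ d∈cs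
... | c₁ , c₂ , refl | as , bs , refl with All-resp-↭ (shift d as bs) closed
... | d-closed ∷ closed′ =
  c₂ ++ c₁ , as ++ bs , closed-rotate c₁ d-closed ∷ closed′ ,
  ↭-trans (concat-↭ (shift d as bs)) (++⁺ʳ (concat (as ++ bs)) rotate) ,
  trans (sum-↭ (map⁺ (weight M ∘ length) (shift d as bs)))
          (cong (λ n → weight M n + totalWeight M (as ++ bs)) (↭-length rotate))
  where
  rotate : c₁ ++ x ∷ c₂ ↭ x ∷ c₂ ++ c₁
  rotate = ++-comm c₁ (x ∷ c₂)

module _ (_≟_ : DecidableEquality V) where

  redirect : V → V → V → V
  redirect n a v with v ≟ n
  ... | yes _ = a
  ... | no _  = v

  redirect-≡ : ∀ {n a v} → v ≡ n → redirect n a v ≡ a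
  redirect-≡ {n} {v = v} v≡n with v ≟ n
  ... | yes _  = refl
  ... | no v≢n = contradiction v≡n v≢n

  redirect-≢ : ∀ {n a v} → v ≢ n → redirect n a v ≡ v
  redirect-≢ {n} {v = v} v≢n with v ≟ n
  ... | yes v≡n = contradiction v≡n v≢n
  ... | no _    = refl

  redirect-idem : ∀ {n a} → redirect n a a ≡ a
  redirect-idem {n} {a} with a ≟ n
  ... | yes _ = refl
  ... | no _  = refl

-- Contraction at n, before n itself is removed from the domain.
module Contraction (_≟_ : DecidableEquality A) (n : A) where

  bypass : (A → A) → A → A
  bypass f x = redirect _≟_ n (f n) (f x)

  module _ {f g : A → A} where

    -- All vertices are moved by the rule for `g`, which sends `n` to `g n`. The rule for `f` sends
    -- `n` to `f n` instead, but the two agree on every source `f x`, since neither moves a vertex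
    -- other than `n`.
    walk-bypass : ∀ {u c v} → All (λ x → f x ≢ n) c → Walk f g u c v →
                  Walk (bypass f) (bypass g) (redirect _≟_ n (g n) u) c (redirect _≟_ n (g n) v)
    walk-bypass [] [] = []
    walk-bypass (fx≢n ∷ avoid) (refl ∷ p) =
      trans (redirect-≢ _≟_ fx≢n) (sym (redirect-≢ _≟_ fx≢n)) ∷ walk-bypass avoid p

    closed-bypass : ∀ {c} → All (λ x → f x ≢ n) c → Closed f g c →
                    Closed (bypass f) (bypass g) c
    closed-bypass [] _ = tt
    closed-bypass {x ∷ c} (fx≢n ∷ avoid) p =
      subst (Walk (bypass f) (bypass g) (bypass g x) c)
            (trans (redirect-≢ _≟_ fx≢n) (sym (redirect-≢ _≟_ fx≢n)))
            (walk-bypass avoid p)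

    -- The node n is an arrow from f n to g n. Let s be the arrow leaving the
    -- vertex n; after the contraction s starts at f n, and the arrow that
    -- entered n ends at g n. So a cycle containing both n and s splits in two,
    -- and otherwise the cycles of n and of s merge.
    contract : ∀ M {s xs cs} → Injective _≡_ _≡_ f → f s ≡ n → s ∈ n ∷ xs → Unique (n ∷ xs) →
               All (Closed f g) cs → concat cs ↭ n ∷ xs →
               ∃ λ cs′ → All (Closed (bypass f) (bypass g)) cs′ × concat cs′ ↭ xs ×
                         totalWeight M cs ≤ totalWeight M cs′ + loss M
    contract M {s} {xs} {cs} f-inj fs≡n s∈ unique closed cs↭
      with extract M (∈-resp-↭ (↭-sym cs↭) s∈) closed
    ... | r , ds , s-closed ∷ ds-closed , cs↭′ , weight≡ = result
      where
      perm : s ∷ r ++ concat ds ↭ n ∷ xs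
      perm = ↭-trans (↭-sym cs↭′) cs↭

      -- By injectivity of `f`, the node `s` is the only one with source `n`.
      avoid : All (λ x → f x ≢ n) (r ++ concat ds)
      avoid with Unique-resp-↭ (↭-sym perm) unique
      ... | s≢ ∷ _ = All.map (λ s≢x fx≡n → s≢x (f-inj (trans fs≡n (sym fx≡n)))) s≢

      s-walk : Walk f g (g s) r n
      s-walk = subst (Walk f g (g s) r) fs≡n s-closed

      avoid-r : All (λ x → f x ≢ n) r
      avoid-r = All.++⁻ˡ r avoid

      avoid-ds : All (λ x → f x ≢ n) (concat ds)
      avoid-ds = All.++⁻ʳ r avoid

      closed-bypass-all : ∀ {es} → All (λ x → f x ≢ n) (concat es) → All (Closed f g) es →
                          All (Closed (bypass f) (bypass g)) es
      closed-bypass-all avoid es-closed =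
        All.zipWith (λ (a , p) → closed-bypass a p) (All.concat⁻ avoid , es-closed)

      Result : Set
      Result = ∃ λ cs′ → All (Closed (bypass f) (bypass g)) cs′ × concat cs′ ↭ xs ×
                         totalWeight M cs ≤ totalWeight M cs′ + loss M

      split-perm : ∀ v u → s ∷ r ≡ v ++ n ∷ u → v ++ u ++ concat ds ↭ xs
      split-perm v u eq = drop-mid v [] (↭-trans (↭-reflexive (begin
        v ++ n ∷ u ++ concat ds      ≡⟨ ++-assoc v (n ∷ u) (concat ds) ⟨
        (v ++ n ∷ u) ++ concat ds    ≡⟨ cong (_++ concat ds) eq ⟨
        s ∷ r ++ concat ds           ∎)) perm)
        where open ≡-Reasoning

      split-weight : ∀ v u → s ∷ r ≡ v ++ n ∷ u →
                     totalWeight M cs ≤ totalWeight M (v ∷ u ∷ ds) + loss M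
      split-weight v u eq = begin
        totalWeight M cs                                 ≡⟨ weight≡ ⟩
        weight M (length (s ∷ r)) + totalWeight M ds
          ≡⟨ cong (λ c → weight M (length c) + totalWeight M ds) eq ⟩
        weight M (length (v ++ n ∷ u)) + totalWeight M ds
          ≡⟨ cong (λ l → weight M l + totalWeight M ds) (length-++ v) ⟩
        weight M (p + suc q) + totalWeight M ds          ≤⟨ +-monoˡ-≤ _ (weight-split M p q) ⟩
        weight M p + weight M q + loss M + totalWeight M ds
          ≡⟨ arith (weight M p) (weight M q) (loss M) (totalWeight M ds) ⟩
        totalWeight M (v ∷ u ∷ ds) + loss M              ∎
        where
        open ≤-Reasoning
        p = length v
        q = length u
        arith : ∀ a b k t → a + b + k + t ≡ a + (b + t) + k
        arith = solve-∀

      -- The final vertex `n` is redirected to `g n`, where the walk began.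
      closed-after : ∀ u → All (λ x → f x ≢ n) u → Walk f g (g n) u n →
                     Closed (bypass f) (bypass g) u
      closed-after u avoid p = walk⇒closed
        (subst₂ (λ a b → Walk (bypass f) (bypass g) a u b) (redirect-idem _≟_) (redirect-≡ _≟_ refl)
                (walk-bypass avoid p))

      result : Result
      result with ∈-++⁻ (s ∷ r) (∈-resp-↭ (↭-sym perm) (here refl))
      ... | inj₁ n∈ = split (∈-∃++ n∈)
        where
        split : (∃₂ λ v u → s ∷ r ≡ v ++ n ∷ u) → Result
        -- Here `s` is `n`, so `f n` is `n`: the cycle merely loses `n`, and the empty list serves
        -- as the first part.
        split ([] , u , eq@refl) =
          [] ∷ r ∷ ds ,
          tt ∷ closed-after r avoid-r s-walk ∷ closed-bypass-all avoid-ds ds-closed ,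
          split-perm [] u eq , split-weight [] u eq
        -- The piece `v` ends at `f n`, which is the new source of `s`; the piece `u` runs from
        -- `g n` to `n` and closes up by `closed-after`.
        split (s ∷ v , u , eq@refl) with walk-++⁻ v s-walk | All.++⁻ v avoid-r
        ... | _ , p , refl ∷ q | avoid-v , fn≢n ∷ avoid-u =
          (s ∷ v) ∷ u ∷ ds ,
          subst (Walk (bypass f) (bypass g) (bypass g s) v)
                (trans (redirect-≢ _≟_ fn≢n) (sym (redirect-≡ _≟_ fs≡n)))
                (walk-bypass avoid-v p) ∷
            closed-after u avoid-u q ∷ closed-bypass-all avoid-ds ds-closed ,
          split-perm (s ∷ v) u eq , split-weight (s ∷ v) u eq
      ... | inj₂ n∈ with extract M n∈ ds-closed
      ...   | w , es , n-closed ∷ es-closed , ds↭ , weight≡′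
        with All-resp-↭ ds↭ avoid-ds
      ...   | fn≢n ∷ avoid-w,es =
        (s ∷ r ++ w) ∷ es ,
        walk-++⁺ (subst (Walk (bypass f) (bypass g) (bypass g s) r) (redirect-≡ _≟_ refl)
                        (walk-bypass avoid-r s-walk))
                 (subst₂ (λ a b → Walk (bypass f) (bypass g) a w b) (redirect-idem _≟_)
                         (trans (redirect-≢ _≟_ fn≢n) (sym (redirect-≡ _≟_ fs≡n)))
                         (walk-bypass (All.++⁻ˡ w avoid-w,es) n-closed)) ∷
          closed-bypass-all (All.++⁻ʳ w avoid-w,es) es-closed ,
        ↭-trans (↭-reflexive (++-assoc (s ∷ r) w (concat es)))
                (drop-mid (s ∷ r) [] (↭-trans (++⁺ˡ (s ∷ r) (↭-sym ds↭)) perm)) ,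
        (begin
          totalWeight M cs                                      ≡⟨ weight≡ ⟩
          weight M (suc p) + totalWeight M ds                   ≡⟨ cong (weight M (suc p) +_) weight≡′ ⟩
          weight M (suc p) + (weight M (suc q) + totalWeight M es)
            ≡⟨ arith₁ (weight M (suc p)) (weight M (suc q)) (totalWeight M es) ⟩
          weight M (suc q) + weight M (suc p) + totalWeight M es
            -- The cycle of `n`, of length `suc q`, is the one that loses a symbol; the cycle of `s`
            -- keeps all its `suc p`.
            ≤⟨ +-monoˡ-≤ _ (weight-mergeable M q (suc p)) ⟩
          weight M (q + suc p) + loss M + totalWeight M es
            ≡⟨ cong (λ l → weight M l + loss M + totalWeight M es) lengths ⟩
          weight M (length (s ∷ r ++ w)) + loss M + totalWeight M es
            ≡⟨ arith₂ (weight M (length (s ∷ r ++ w))) (loss M) (totalWeight M es) ⟩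
          totalWeight M ((s ∷ r ++ w) ∷ es) + loss M            ∎)
        where
        open ≤-Reasoning
        p = length r
        q = length w
        lengths : q + suc p ≡ length (s ∷ r ++ w)
        lengths = trans (+-comm q (suc p)) (sym (cong suc (length-++ r)))
        arith₁ : ∀ a b t → a + (b + t) ≡ b + a + t
        arith₁ = solve-∀
        arith₂ : ∀ a k t → a + k + t ≡ a + t + k
        arith₂ = solve-∀

-- Contraction of permutations

open Contraction using (bypass; contract)

injective⇒hits-last : ∀ {n} {f : Fin (suc n) → Fin (suc n)} → Injective _≡_ _≡_ f →
                      ∃ λ s → f s ≡ fromℕ n
injective⇒hits-last {n} f-inj with injective⇒existsPivot f-inj (fromℕ n)
... | s , _ , last≤fs = s , toℕ-injective (≤-antisym (≤fromℕ _) last≤fs)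

inject₁-trim : ∀ {n} (d : Fin n) {y} → y ≢ fromℕ n → inject₁ (trim d y) ≡ y
inject₁-trim {n} d {y} y≢last with toℕ y <? n
... | yes y<n = toℕ-injective (trans (toℕ-inject₁ _) (toℕ-fromℕ< y<n))
... | no y≮n = contradiction
  (≤∧≢⇒< (toℕ≤pred[n] y) (λ y≡n → y≢last (toℕ-injective (trans y≡n (sym (toℕ-fromℕ n)))))) y≮n

module _ {n} {f : Fin (suc n) → Fin (suc n)} (f-inj : Injective _≡_ _≡_ f) where

  -- If `f` sends `inject₁ x` to the last symbol, then by injectivity it does not send the last
  -- symbol to itself, so `trim` returns a genuine value in both branches.
  inject₁-ct : ∀ x → bypass _≟ᶠ_ (fromℕ n) f (inject₁ x) ≡ inject₁ (ct f x)
  inject₁-ct x with f (inject₁ x) ≟ᶠ fromℕ n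
  ... | no fx≢last = sym (inject₁-trim x fx≢last)
  ... | yes fx≡last = sym (inject₁-trim x
    (λ fn≡last → fromℕ≢inject₁ (f-inj (trans fn≡last (sym fx≡last)))))

  ct-injective : Injective _≡_ _≡_ (ct f)
  ct-injective {x} {y} eq =
    inject₁-injective (same-node (trans (inject₁-ct x) (trans (cong inject₁ eq) (sym (inject₁-ct y)))))
    where
    same-node : bypass _≟ᶠ_ (fromℕ n) f (inject₁ x) ≡ bypass _≟ᶠ_ (fromℕ n) f (inject₁ y) →
                inject₁ x ≡ inject₁ y
    same-node eq with f (inject₁ x) ≟ᶠ fromℕ n | f (inject₁ y) ≟ᶠ fromℕ n
    ... | yes p | yes q = f-inj (trans p (sym q))
    -- In the mixed cases `f` would take the same value at the last symbol and at some `inject₁`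
    -- symbol.
    ... | yes _ | no _  = ⊥-elim (fromℕ≢inject₁ (f-inj eq))
    ... | no _  | yes _ = ⊥-elim (fromℕ≢inject₁ (sym (f-inj eq)))
    ... | no _  | no _  = f-inj eq

-- Decompositions into closed walks

Decomposition : ∀ {n} → (f g : Fin n → Fin n) → List (List (Fin n)) → Set
Decomposition {n} f g cs = All (Closed f g) cs × concat cs ↭ allFin n

totalWeight-map : ∀ M (h : A → B) cs → totalWeight M (map (map h) cs) ≡ totalWeight M cs
totalWeight-map M h cs = cong sum (trans (sym (map-∘ cs))
  (map-cong (λ c → cong (weight M) (length-map h c)) cs))

-- `contract` at the last symbol yields closed walks of the bypassed maps on `Fin (suc n)`. Their
-- nodes all avoid the last symbol, so they come from `Fin n`, where `inject₁-ct` turns bypassing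
-- into `ct`.
decomposition-ct : ∀ M {n} {f g : Fin (suc n) → Fin (suc n)} →
                   Injective _≡_ _≡_ f → Injective _≡_ _≡_ g → ∀ {cs} → Decomposition f g cs →
                   ∃ λ cs′ → Decomposition (ct f) (ct g) cs′ ×
                             totalWeight M cs ≤ totalWeight M cs′ + loss M
decomposition-ct M {n} {f} {g} f-inj g-inj {cs} (closed , cs↭) with injective⇒hits-last f-inj
... | s , fs≡last with contract _≟ᶠ_ (fromℕ n) {f} {g} M f-inj fs≡last
                         (∈-resp-↭ (allFin-suc n) (∈-allFin s))
                         (Unique-resp-↭ (allFin-suc n) (allFin⁺ (suc n)))
                         closed (↭-trans cs↭ (allFin-suc n))
... | ds , ds-closed , ds↭ , weight≤ with ↭-map-inv inject₁ (↭-sym ds↭)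
... | ys , ds≡ , ys↭ with concat-map⁻ inject₁ ds ds≡
... | cs′ , refl , refl =
  cs′ ,
  (All.map (λ {c} → closed-map⁻ (inject₁-ct f-inj) (inject₁-ct g-inj) inject₁-injective c)
           (All.map⁻ ds-closed) ,
   ↭-sym ys↭) ,
  subst (λ w → totalWeight M cs ≤ w + loss M) (totalWeight-map M inject₁ cs′) weight≤

-- The cycle decomposition of `g` is obtained by undoing one contraction: decompose `ct g`, then put
-- the last symbol back behind its preimage `t`.
decomposition-id : ∀ n {g : Fin n → Fin n} → Injective _≡_ _≡_ g → ∃ (Decomposition id g)
decomposition-id zero _ = [] , [] , ↭-refl
decomposition-id (suc n) {g} g-inj
  with decomposition-id n (ct-injective g-inj) | injective⇒hits-last g-inj
... | cs , closed , cs↭ | t , gt≡last = result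
  where
  last : Fin (suc n)
  last = fromℕ n

  ds : List (List (Fin (suc n)))
  ds = map (map inject₁) cs

  ds-closed : All (Closed id (bypass _≟ᶠ_ last g)) ds
  ds-closed = All.map⁺ (All.map (closed-map (λ _ → refl) (inject₁-ct g-inj)) closed)

  ds↭ : last ∷ concat ds ↭ allFin (suc n)
  ds↭ = ↭-trans (prep last (↭-trans (↭-reflexive (concat-map cs)) (map⁺ inject₁ cs↭)))
                (↭-sym (allFin-suc n))

  ds-unique : Unique (last ∷ concat ds)
  ds-unique = Unique-resp-↭ (↭-sym ds↭) (allFin⁺ (suc n))

  -- Only `t` is sent to `last`, so bypassing leaves `g` unchanged at every other node.
  unbypass : ∀ {c} → All (t ≢_) c → All (λ x → bypass _≟ᶠ_ last g x ≡ g x) c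
  unbypass = All.map (λ t≢x → redirect-≢ _≟ᶠ_ λ gx≡last → t≢x (g-inj (trans gt≡last (sym gx≡last))))

  unbypass-all : ∀ {es} → All (t ≢_) (concat es) →
                 All (Closed id (bypass _≟ᶠ_ last g)) es → All (Closed id g) es
  unbypass-all t≢ es-closed =
    All.zipWith (λ (t≢c , p) → closed-cong (unbypass t≢c) p) (All.concat⁻ t≢ , es-closed)

  result : ∃ (Decomposition id g)
  result with ∈-resp-↭ (↭-sym ds↭) (∈-allFin t) | ds-unique
  ... | here refl | last≢ ∷ _ =
    [ last ] ∷ ds ,
    subst (λ v → Walk id g v [] last) (sym gt≡last) [] ∷ unbypass-all last≢ ds-closed , ds↭
  ... | there t∈ | _ ∷ unique with extract 0 t∈ ds-closed
  ...   | r , es , t-closed ∷ es-closed , ds↭′ , _ with Unique-resp-↭ ds↭′ unique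
  ...     | t≢ ∷ _ =
    -- The bypassed arrow from `t` to `g last` is replaced by the two arrows from `t` to `last` and
    -- from `last` to `g last`.
    (t ∷ last ∷ r) ∷ es ,
    (sym gt≡last ∷ subst (λ v → Walk id g v r t) (redirect-≡ _≟ᶠ_ gt≡last)
                         (walk-cong {g = bypass _≟ᶠ_ last g} (unbypass (All.++⁻ˡ r t≢)) t-closed)) ∷
      unbypass-all (All.++⁻ʳ r t≢) es-closed ,
    ↭-trans (swap t last ↭-refl) (↭-trans (prep last (↭-sym ds↭′)) ds↭)

perm-injective : ∀ {n} (π : Permutation′ n) → Injective _≡_ _≡_ ⟦ π ⟧
perm-injective π eq = trans (sym (inverseˡ π)) (trans (cong (π ⟨$⟩ˡ_) eq) (inverseˡ π))

-- First decompose the map sending `x` to the preimage under `σ` of `τ x`. Applying `σ` to the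
-- vertices, but not to the nodes, turns an arrow from `x` into one from `σ x` to `τ x`.
decomposition : ∀ {n} (σ τ : Permutation′ n) → ∃ (Decomposition ⟦ σ ⟧ ⟦ τ ⟧)
decomposition {n} σ τ with decomposition-id n {λ x → σ ⟨$⟩ˡ ⟦ τ ⟧ x}
  (λ eq → perm-injective τ (perm-injective (flip σ) eq))
... | cs , closed , cs↭ = cs , All.map (λ {c} → relabel {c}) closed , cs↭
  where
  relabel : ∀ {c} → Closed id (λ x → σ ⟨$⟩ˡ ⟦ τ ⟧ x) c → Closed ⟦ σ ⟧ ⟦ τ ⟧ c
  relabel {c} p = subst (Closed ⟦ σ ⟧ ⟦ τ ⟧) (map-id c)
    (closed-map {h = id} {k = ⟦ σ ⟧} (λ _ → refl) (λ x → sym (inverseʳ σ)) p)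

-- Hamming distance against weight

module _ {n} (f g : Fin n → Fin n) where

  differ? : Decidable (λ x → f x ≢ g x)
  differ? x = ¬? (f x ≟ᶠ g x)

  hdOn : List (Fin n) → ℕ
  hdOn = length ∘ filter differ?

module _ {n} {f g : Fin n → Fin n} where

  hdOn-concat : ∀ c cs → hdOn f g (concat (c ∷ cs)) ≡ hdOn f g c + hdOn f g (concat cs)
  hdOn-concat c cs = trans (cong length (filter-++ (differ? f g) c (concat cs))) (length-++ (filter (differ? f g) c))

  hd≡hdOn : ∀ {xs} → xs ↭ allFin n → hd f g ≡ hdOn f g xs
  hd≡hdOn p = sym (↭-length (filter-↭ (differ? f g) p))

  hdOn≤totalWeight : ∀ M {cs} → All (λ c → M * hdOn f g c ≤ weight M (length c)) cs →
                     M * hdOn f g (concat cs) ≤ totalWeight M cs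
  hdOn≤totalWeight M [] = ≤-reflexive (*-zeroʳ M)
  hdOn≤totalWeight M {c ∷ cs} (le ∷ les) = begin
    M * hdOn f g (concat (c ∷ cs))               ≡⟨ cong (M *_) (hdOn-concat c cs) ⟩
    M * (hdOn f g c + hdOn f g (concat cs))      ≡⟨ *-distribˡ-+ M (hdOn f g c) _ ⟩
    M * hdOn f g c + M * hdOn f g (concat cs)    ≤⟨ +-mono-≤ le (hdOn≤totalWeight M les) ⟩
    totalWeight M (c ∷ cs)                       ∎
    where open ≤-Reasoning

  totalWeight≤hdOn : ∀ M {cs} → All (λ c → weight M (length c) ≤ M * hdOn f g c) cs →
                     totalWeight M cs ≤ M * hdOn f g (concat cs)
  totalWeight≤hdOn M [] = z≤n
  totalWeight≤hdOn M {c ∷ cs} (le ∷ les) = begin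
    totalWeight M (c ∷ cs)                       ≤⟨ +-mono-≤ le (totalWeight≤hdOn M les) ⟩
    M * hdOn f g c + M * hdOn f g (concat cs)    ≡⟨ *-distribˡ-+ M (hdOn f g c) _ ⟨
    M * (hdOn f g c + hdOn f g (concat cs))      ≡⟨ cong (M *_) (hdOn-concat c cs) ⟨
    M * hdOn f g (concat (c ∷ cs))               ∎
    where open ≤-Reasoning

  hdOn-singleton : ∀ {x} → Closed f g [ x ] → hdOn f g [ x ] ≡ 0
  hdOn-singleton {x} p = cong length (filter-reject (differ? f g) {x} {[]} (λ fx≢gx → fx≢gx (sym (endpoints p))))
    where
    endpoints : ∀ {u v} → Walk f g u [] v → u ≡ v
    endpoints [] = refl

  -- Rotate `x` to the front. A following node `y` would satisfy `f y ≡ g x ≡ f x`, so `y` would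
  -- repeat `x`.
  fixed⇒singleton : ∀ {c x} → Injective _≡_ _≡_ f → Closed f g c → Unique c → x ∈ c →
                    f x ≡ g x → length c ≡ 1
  fixed⇒singleton f-inj closed unique x∈c fx≡gx with ∈-∃++ x∈c
  ... | c₁ , c₂ , refl
    with c₂ ++ c₁ | ↭-length (++-comm c₁ (_ ∷ c₂)) | closed-rotate c₁ closed
       | Unique-resp-↭ (++-comm c₁ (_ ∷ c₂)) unique
  ... | [] | len | _ | _ = len
  ... | y ∷ _ | _ | fy≡gx ∷ _ | (x≢y ∷ _) ∷ _ =
    contradiction (f-inj (trans fx≡gx (sym fy≡gx))) x≢y

  -- A singleton weighs 0. On a longer cycle `f` and `g` differ at every node, so its Hamming
  -- distance is its length and `weight-≤` applies, whatever the parity.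
  weight≤hdOn : ∀ M → Injective _≡_ _≡_ f → ∀ {c} → Closed f g c × Unique c →
                 weight M (length c) ≤ M * hdOn f g c
  weight≤hdOn M f-inj {[]} _ = z≤n
  weight≤hdOn M f-inj {x ∷ []} _ = z≤n
  weight≤hdOn M f-inj {c@(x ∷ y ∷ _)} (closed , unique) = begin
    weight M (length c)  ≤⟨ weight-≤ M (length c) ⟩
    M * length c         ≡⟨ cong (λ l → M * length l) (filter-all (differ? f g) all-differ) ⟨
    M * hdOn f g c       ∎
    where
    open ≤-Reasoning
    all-differ : All (λ z → f z ≢ g z) c
    all-differ = All.tabulate λ z∈c fz≡gz → case fixed⇒singleton f-inj closed unique z∈c fz≡gz of λ ()

-- Closed walks as cycles of the quotient permutation

iter-suc : ∀ {A : Set} (π : A → A) j x → iter π (suc j) x ≡ iter π j (π x)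
iter-suc π zero x = refl
iter-suc π (suc j) x = cong π (iter-suc π j x)

module _ {n} (σ τ : Permutation′ n) where

  private
    π : Fin n → Fin n
    π = invComp σ τ

    π∘σ : ∀ x → π (⟦ σ ⟧ x) ≡ ⟦ τ ⟧ x
    π∘σ x = cong ⟦ τ ⟧ (inverseˡ σ)

  iter-walk : ∀ {u c v} → Walk ⟦ σ ⟧ ⟦ τ ⟧ u c v → iter π (length c) u ≡ v
  iter-walk [] = refl
  iter-walk {c = x ∷ c} (refl ∷ p) =
    trans (iter-suc π (length c) _) (trans (cong (iter π (length c)) (π∘σ x)) (iter-walk p))

  iter-∈ : ∀ {u c v} → Walk ⟦ σ ⟧ ⟦ τ ⟧ u c v → ∀ {j} → j < length c →
           ∃ λ y → y ∈ c × iter π j u ≡ ⟦ σ ⟧ y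
  iter-∈ (refl ∷ p) {zero} _ = _ , here refl , refl
  iter-∈ {c = x ∷ c} (refl ∷ p) {suc j} (s≤s j<) with iter-∈ p j<
  ... | y , y∈c , eq =
    y , there y∈c , trans (iter-suc π j _) (trans (cong (iter π j) (π∘σ x)) eq)

  -- Following the walk once around is iteration of `π`. A return before the end would meet the
  -- source of a later node `y` with `σ y` equal to `σ x`, which contradicts uniqueness of the
  -- nodes.
  closed⇒inCycle : ∀ {x c} → Closed ⟦ σ ⟧ ⟦ τ ⟧ (x ∷ c) → Unique (x ∷ c) →
                   InCycleOfLength π (⟦ σ ⟧ x) (length (x ∷ c))
  closed⇒inCycle {x} {c} p (x∉c ∷ _) = s≤s z≤n , iter-walk (refl ∷ p) , minimal
    where
    minimal : ∀ j → 1 ≤ j → j < length (x ∷ c) → iter π j (⟦ σ ⟧ x) ≢ ⟦ σ ⟧ x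
    minimal (suc j) _ (s≤s j<) returns with iter-∈ p j<
    ... | y , y∈c , eq = All.lookup x∉c y∈c (perm-injective σ (trans (sym returns)
      (trans (iter-suc π j _) (trans (cong (iter π j) (π∘σ x)) eq))))

  -- The hypothesis on odd cycles enters here: it forces an odd cycle of length `2i + 1` with at
  -- least two nodes to have `m < i`, which is the condition `M ≤ i` of `weight-≥` for `M = m + 1`.
  hdOn≤weight : ∀ m →
    (∀ x ℓ → Odd ℓ → 3 ≤ ℓ → ℓ ≤ 2 * m + 1 → ¬ InCycleOfLength π x ℓ) →
    ∀ {c} → Closed ⟦ σ ⟧ ⟦ τ ⟧ c × Unique c →
    suc m * hdOn ⟦ σ ⟧ ⟦ τ ⟧ c ≤ weight (suc m) (length c)
  hdOn≤weight m _ {[]} _ = ≤-reflexive (*-zeroʳ m)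
  hdOn≤weight m _ {x ∷ []} (p , _) =
    ≤-reflexive (trans (cong (suc m *_) (hdOn-singleton p)) (*-zeroʳ m))
  hdOn≤weight m no-odd {c@(x ∷ _ ∷ _)} (p , unique) =
    ≤-trans (*-monoʳ-≤ (suc m) (length-filter (differ? ⟦ σ ⟧ ⟦ τ ⟧) c)) (weight-≥ (suc m) (length c) long)
    where
    long : ∀ i → length c ≡ suc (i * 2) → m < i
    long i len with m <? i
    ... | yes m<i = m<i
    ... | no m≮i = ⊥-elim (no-odd (⟦ σ ⟧ x) (length c) is-odd is-long is-short
                                  (closed⇒inCycle p unique))
      where
      is-odd : Odd (length c)
      is-odd = subst Odd (sym (trans len (cong suc (double i)))) (odd i)
        where
        double : ∀ i → i * 2 ≡ i + i
        double = solve-∀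
      is-long : 3 ≤ length c
      is-long = at-least-3 i len
        where
        -- The index 0 would mean length 1, which the two leading nodes rule out.
        at-least-3 : ∀ i {l} → suc (suc l) ≡ suc (i * 2) → 3 ≤ suc (suc l)
        at-least-3 (suc i) refl = s≤s (s≤s (s≤s z≤n))
      is-short : length c ≤ 2 * m + 1
      is-short = begin
        length c      ≡⟨ len ⟩
        suc (i * 2)   ≤⟨ s≤s (*-monoˡ-≤ 2 (≮⇒≥ m≮i)) ⟩
        suc (m * 2)   ≡⟨ arith m ⟩
        2 * m + 1     ∎
        where
        open ≤-Reasoning
        arith : ∀ m → suc (m * 2) ≡ 2 * m + 1
        arith = solve-∀

-- The estimate under iterated contraction

unique-concat⁻ : {xss : List (List A)} → Unique (concat xss) → All Unique xss
unique-concat⁻ {xss = []} _ = []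
unique-concat⁻ {xss = xs ∷ xss} u = left xs u ∷ unique-concat⁻ (right xs u)
  where
  left : ∀ xs {ys : List _} → Unique (xs ++ ys) → Unique xs
  left [] _ = []
  left (x ∷ xs) (x∉ ∷ u) = All.++⁻ˡ xs x∉ ∷ left xs u
  right : ∀ xs {ys : List _} → Unique (xs ++ ys) → Unique ys
  right [] u = u
  right (x ∷ xs) (_ ∷ u) = right xs u

closed-unique : ∀ {n} {f g : Fin n → Fin n} {cs} → Decomposition f g cs →
                All (λ c → Closed f g c × Unique c) cs
closed-unique {n} (closed , cs↭) =
  All.zip (closed , unique-concat⁻ (Unique-resp-↭ (↭-sym cs↭) (allFin⁺ n)))

-- Each contraction costs at most `loss M`. The remaining weight is compared with the Hamming
-- distance only at the end, by a bound that tolerates any short odd cycles created on the way.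
weight≤hd-ctIter : ∀ M m {k} {f g : Fin (m + k) → Fin (m + k)} →
                   Injective _≡_ _≡_ f → Injective _≡_ _≡_ g → ∀ {cs} → Decomposition f g cs →
                   totalWeight M cs ≤ M * hd (ctIter m f) (ctIter m g) + m * loss M
weight≤hd-ctIter M zero {f = f} {g} f-inj g-inj {cs} dec@(_ , cs↭) = begin
  totalWeight M cs
    ≤⟨ totalWeight≤hdOn M (All.map (weight≤hdOn M f-inj) (closed-unique dec)) ⟩
  M * hdOn f g (concat cs)  ≡⟨ cong (M *_) (hd≡hdOn cs↭) ⟨
  M * hd f g                ≡⟨ +-identityʳ _ ⟨
  M * hd f g + 0            ∎
  where open ≤-Reasoning
weight≤hd-ctIter M (suc m) {f = f} {g} f-inj g-inj {cs} dec
  with decomposition-ct M f-inj g-inj dec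
... | cs′ , dec′ , weight≤ = begin
  totalWeight M cs            ≤⟨ weight≤ ⟩
  totalWeight M cs′ + loss M
    ≤⟨ +-monoˡ-≤ _ (weight≤hd-ctIter M m (ct-injective f-inj) (ct-injective g-inj) dec′) ⟩
  M * h + m * loss M + loss M ≡⟨ arith (M * h) (m * loss M) (loss M) ⟩
  M * h + suc m * loss M      ∎
  where
  open ≤-Reasoning
  h = hd (ctIter (suc m) f) (ctIter (suc m) g)
  arith : ∀ a b c → a + b + c ≡ a + (c + b)
  arith = solve-∀

theorem5p2 : (m k : ℕ) → 1 ≤ m → 1 ≤ k →
    (σ τ : Permutation′ (m + k)) → (d : ℕ) → hd ⟦ σ ⟧ ⟦ τ ⟧ ≡ d →
    (∀ (x : Fin (m + k)) (ℓ : ℕ) → Odd ℓ → 3 ≤ ℓ → ℓ ≤ 2 * m + 1 →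
    ¬ InCycleOfLength (invComp σ τ) x ℓ) →
    hd (ctIter m ⟦ σ ⟧) (ctIter m ⟦ τ ⟧) ≥ d ∸ 2 * m
theorem5p2 m k _ _ σ τ d refl no-odd with decomposition σ τ
... | cs , dec@(_ , cs↭) = m≤n+o⇒m∸n≤o d (2 * m) (≮⇒≥ too-small)
  where
  -- The extra 1 in `loss M` accumulates to `m` over all contractions, and `M` is chosen just above
  -- that.
  M = suc m
  d′ = hd (ctIter m ⟦ σ ⟧) (ctIter m ⟦ τ ⟧)

  bound : M * d ≤ M * d′ + m * loss M
  bound = begin
    M * d                                ≡⟨ cong (M *_) (hd≡hdOn cs↭) ⟩
    M * hdOn ⟦ σ ⟧ ⟦ τ ⟧ (concat cs)
      ≤⟨ hdOn≤totalWeight M (All.map (hdOn≤weight σ τ m no-odd) (closed-unique dec)) ⟩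
    totalWeight M cs                     ≤⟨ weight≤hd-ctIter M m (perm-injective σ) (perm-injective τ) dec ⟩
    M * d′ + m * loss M                  ∎
    where open ≤-Reasoning

  too-small : ¬ (2 * m + d′ < d)
  -- Dividing by `M` with rounding: a deficit of one would put an extra `M` on the left of `bound`,
  -- against only `m` on the right.
  too-small lt = 1+n≰n (+-cancelˡ-≤ (M * (2 * m + d′)) M m (begin
    M * (2 * m + d′) + M     ≡⟨ arith₁ M (2 * m + d′) ⟩
    M * suc (2 * m + d′)     ≤⟨ *-monoʳ-≤ M lt ⟩
    M * d                    ≤⟨ bound ⟩
    M * d′ + m * loss M      ≡⟨ arith₂ M m d′ ⟩
    M * (2 * m + d′) + m     ∎))
    where
    open ≤-Reasoning
    arith₁ : ∀ M e → M * e + M ≡ M * suc e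
    arith₁ = solve-∀
    arith₂ : ∀ M m d′ → M * d′ + m * suc (2 * M) ≡ M * (2 * m + d′) + m
    arith₂ = solve-∀
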